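{- Let $(\Omega,\le)$ be a set with a decidable well-quasi-order $\le$, and let $V\subseteq\Omega$ be upward-closed and recursively enumerable. Then the finite set $V_{min}$ of minimal elements of $V$ is effectively constructible if and only if for every finite subset $X\subseteq\Omega$ it is decidable whether $V\cap\overline{X\!\uparrow}\neq\emptyset$ (i.e., whether $\exists v\in V.\ v\notin X\!\uparrow$).
   Context: For $X\subseteq\Omega$, $X\!\uparrow=\{a\in\Omega\mid\exists x\in X.\ x\le a\}$ is the upward closure and $\overline{X\!\uparrow}=\Omega\setminus X\!\uparrow$. $V$ is upward-closed if $V=V\!\uparrow$. Elements of $\Omega$ are assumed to have finite representations, $\le$ is decidable on them, and $V$ is given by a procedure enumerating it. "Decidable for every finite $X$" means decidable uniformly with $X$ as input. If $\le$ is not antisymmetric, "the finite set of minimal elements of $V$" is understood as a finite set of minimal elements containing one representative per equivalence class, so that its upward closure is $V$. -}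

-- Computability is read synthetically: a function of this constructive theory
-- is an algorithm.  "Effectively constructible" is therefore an explicit
-- witness, "decidable uniformly in X" is a function into Dec, and an
-- equivalence between the two is a pair of algorithms, each turning one kind
-- of procedure into the other, uniformly in all the data (order and V).

module Defs where

open import Level using (0ℓ)
open import Data.Bool using (Bool)
open import Data.List using (List)
open import Data.List.Membership.Propositional using () renaming (_∈_ to _∈ˡ_)
open import Data.List.Relation.Unary.All using (All)
open import Data.List.Relation.Unary.Any using (Any)
open import Data.List.Relation.Unary.AllPairs using (AllPairs)
open import Data.Maybe using (Maybe; just)
open import Data.Nat using (ℕ) renaming (_<_ to _<ℕ_)
open import Data.Product using (∃-syntax; Σ-syntax; _×_)
open import Function.Bundles using (_↣_)
open import Relation.Binary using (Rel; Decidable; IsPreorder)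
open import Relation.Binary.PropositionalEquality using (_≡_)
open import Relation.Nullary using (¬_; Irrelevant)
open import Relation.Unary using (Pred; _∈_; _≐_)

-- The mere existence of an element of A: it can only be used to derive
-- statements with at most one proof.  Dec ∥ A ∥ is a bare yes/no answer,
-- whereas the yes case of Dec (∃ …) would also hand over a witness.
∥_∥ : Set → Set₁
∥ A ∥ = ∀ {P : Set} → Irrelevant P → (A → P) → P

-- Elements have finite representations: distinct elements are named by
-- distinct binary words.
FinitelyRepresented : Set → Set
FinitelyRepresented Ω = Ω ↣ List Bool

-- The enumeration may output nothing at a step, so that V may be empty.
RecursivelyEnumerable : {Ω : Set} → Pred Ω 0ℓ → Set
RecursivelyEnumerable {Ω} V =
  Σ[ e ∈ (ℕ → Maybe Ω) ] V ≐ (λ (a : Ω) → ∃[ n ] e n ≡ just a)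

record IsDecWellQuasiOrder {Ω : Set} (_≤_ : Rel Ω 0ℓ) : Set where
  field
    isPreorder : IsPreorder _≡_ _≤_
    _≤?_       : Decidable _≤_
    good       : (f : ℕ → Ω) → ∃[ i ] ∃[ j ] (i <ℕ j × f i ≤ f j)

⟦_⟧ : {Ω : Set} → List Ω → Pred Ω 0ℓ
⟦ xs ⟧ a = a ∈ˡ xs

module Order {Ω : Set} (_≤_ : Rel Ω 0ℓ) where

  infix 10 _↑

  _↑ : Pred Ω 0ℓ → Pred Ω 0ℓ
  (X ↑) a = ∃[ x ] (x ∈ X × x ≤ a)

  UpwardClosed : Pred Ω 0ℓ → Set
  UpwardClosed V = V ≐ V ↑

  _∼_ : Rel Ω 0ℓ
  a ∼ b = a ≤ b × b ≤ a

  -- Nothing in V lies strictly below v; antisymmetry is not assumed.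
  Minimal : Pred Ω 0ℓ → Pred Ω 0ℓ
  Minimal V v = v ∈ V × (∀ {w} → w ∈ V → w ≤ v → v ≤ w)

  -- M lists the minimal elements of V, exactly one from each ∼-class (so all
  -- of them, once each, when ≤ is antisymmetric).
  record IsVmin (V : Pred Ω 0ℓ) (M : List Ω) : Set where
    field
      minimal      : All (Minimal V) M
      inequivalent : AllPairs (λ a b → ¬ (a ∼ b)) M
      complete     : ∀ {v} → Minimal V v → Any (_∼ v) M
      generates    : V ≐ ⟦ M ⟧ ↑

{-# OPTIONS --safe #-}
-- Constructing V_min from the decision procedure: grow a list X inside V by
-- adding an element of V outside X↑ as long as there is one.  As ≤ is a
-- well-quasi-order this stops, and then V = X↑; discarding dominated elements
-- of X leaves an antichain, whose elements are the minimal ones.  The procedure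
-- only says whether an element of V outside X↑ exists; when it does, the least
-- index at which the enumeration of V outputs one is unique, so it survives the
-- truncation.  Conversely, V leaves X↑ iff one of its minimal elements does.
module Submission where

open import Defs
open import Level using (0ℓ)
open import Data.Bool.Properties using (T-irrelevant)
open import Data.List using (List; []; _∷_; filter)
open import Data.List.Membership.Propositional using (find; lose) renaming (_∈_ to _∈ˡ_)
open import Data.List.Membership.Propositional.Properties using (∈-filter⁺)
open import Data.List.Relation.Unary.All as All using (All; []; _∷_)
open import Data.List.Relation.Unary.All.Properties using (all-filter; ¬Any⇒All¬) renaming (filter⁺ to all-filter⁺)
open import Data.List.Relation.Unary.AllPairs as AllPairs using (AllPairs; []; _∷_)
open import Data.List.Relation.Unary.AllPairs.Properties using () renaming (filter⁺ to allPairs-filter⁺)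
open import Data.List.Relation.Unary.Any using (any?; here; there)
open import Data.Maybe using (Maybe; just)
import Data.Maybe.Relation.Unary.Any as Maybe
open import Data.Nat using (ℕ; zero; suc) renaming (_<_ to _<ℕ_)
open import Data.Nat.Induction using (<-rec)
open import Data.Nat.Properties using (anyUpTo?; <-cmp; m<1+n⇒m<n∨m≡n)
open import Data.Product using (∃-syntax; Σ-syntax; _×_; _,_; proj₁; proj₂)
open import Data.Sum using (inj₁; inj₂)
open import Function.Base using (_∘_)
open import Function.Bundles using (_⇔_; mk⇔)
open import Relation.Binary using (Rel; IsPreorder; tri<; tri≈; tri>)
open import Relation.Binary.PropositionalEquality using (_≡_; refl; sym; cong; subst)
open import Relation.Nullary using (Dec; yes; no; ¬_; ¬?; _×-dec_; Irrelevant; contradiction)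
open import Relation.Nullary.Decidable using (True; toWitness; fromWitness; map′; decidable-stable)
open import Relation.Unary using (Pred; Decidable; ∁; _∩_; _∈_; _⊆_; _≐_; Satisfiable)

∥∥-rec-⊥ : {A : Set} → ¬ A → ¬ ∥ A ∥
∥∥-rec-⊥ ¬a ∥a∥ = ∥a∥ (λ ()) ¬a

dec-∥∥⁺ : {A : Set} → Dec A → Dec ∥ A ∥
dec-∥∥⁺ (yes a) = yes λ _ f → f a
dec-∥∥⁺ (no ¬a) = no (∥∥-rec-⊥ ¬a)

dec-∥∥⁻ : {A : Set} → (∥ A ∥ → A) → Dec ∥ A ∥ → Dec A
dec-∥∥⁻ out = map′ out λ a _ f → f a

module _ {Q : Pred ℕ 0ℓ} (Q? : Decidable Q) where

  Least : Pred ℕ 0ℓ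
  Least n = Q n × ¬ (∃[ m ] (m <ℕ n × Q m))

  least? : Decidable Least
  least? n = Q? n ×-dec ¬? (anyUpTo? Q? n)

  least-unique : ∀ {m n} → Least m → Least n → m ≡ n
  least-unique {m} {n} (qm , ¬<m) (qn , ¬<n) with <-cmp m n
  ... | tri< m<n _ _ = contradiction (m , m<n , qm) ¬<n
  ... | tri≈ _ m≡n _ = m≡n
  ... | tri> _ _ n<m = contradiction (n , n<m , qn) ¬<m

  least-exists : ∃⟨ Q ⟩ → ∃⟨ Least ⟩
  least-exists (n , qn) = <-rec (λ n → Q n → ∃⟨ Least ⟩) step n qn
    where
    step : ∀ n → (∀ {m} → m <ℕ n → Q m → ∃⟨ Least ⟩) → Q n → ∃⟨ Least ⟩
    step n rec qn with anyUpTo? Q? n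
    ... | yes (m , m<n , qm) = rec m<n qm
    ... | no ¬<n             = n , qn , ¬<n

  -- True makes the proof of minimality irrelevant without function
  -- extensionality.
  leastWitness-irrelevant : Irrelevant (Σ[ n ∈ ℕ ] True (least? n))
  leastWitness-irrelevant (m , p) (n , q)
    with refl ← least-unique (toWitness p) (toWitness q) =
    cong (m ,_) (T-irrelevant p q)

  ∥∥-search : ∥ ∃⟨ Q ⟩ ∥ → ∃⟨ Q ⟩
  ∥∥-search ∥q∥ =
    let n , p = ∥q∥ leastWitness-irrelevant
                  λ w → let n , l = least-exists w in n , fromWitness l
    in n , proj₁ (toWitness p)

any-just : {A : Set} {P : Pred A 0ℓ} {m : Maybe A} →
           Maybe.Any P m → ∃[ a ] (m ≡ just a × P a)
any-just (Maybe.just p) = _ , refl , p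

-- Membership in `V` is only semi-decidable, so the search runs over indices: whether `e n` outputs
-- an element satisfying `P` is decidable in `n`. The truncation is carried over to indices by
-- precomposing with `index`.
∥∥-search-re : {Ω : Set} {V P : Pred Ω 0ℓ} → RecursivelyEnumerable V →
               Decidable P → ∥ ∃⟨ V ∩ P ⟩ ∥ → ∃⟨ V ∩ P ⟩
∥∥-search-re {V = V} {P} (e , V⊆e , e⊆V) P? ∥v∥ =
  let n , p         = ∥∥-search (λ n → Maybe.dec P? (e n))
                        λ irr f → ∥v∥ irr (f ∘ index)
      a , eq , pa   = any-just p
  in a , e⊆V (n , eq) , pa
  where
  index : ∃⟨ V ∩ P ⟩ → ∃[ n ] Maybe.Any P (e n)
  index (a , va , pa) with n , eq ← V⊆e va =
    n , subst (Maybe.Any P) (sym eq) (Maybe.just pa)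

module _ {Ω : Set} {_≤_ : Rel Ω 0ℓ} (wqo : IsDecWellQuasiOrder _≤_) where

  open Order _≤_
  open IsDecWellQuasiOrder wqo
  open IsPreorder isPreorder using () renaming (refl to ≤-refl; trans to ≤-trans)

  ↑? : ∀ X → Decidable (⟦ X ⟧ ↑)
  ↑? X a = map′ find (λ (_ , x∈X , x≤a) → lose x∈X x≤a) (any? (_≤? a) X)

  ↑-least : ∀ {X Y} → All (⟦ Y ⟧ ↑) X → ⟦ X ⟧ ↑ ⊆ ⟦ Y ⟧ ↑
  ↑-least X⊆Y↑ (x , x∈X , x≤a) with y , y∈Y , y≤x ← All.lookup X⊆Y↑ x∈X =
    y , y∈Y , ≤-trans y≤x x≤a

  Incomparable : Rel Ω 0ℓ
  Incomparable a b = ¬ (a ≤ b) × ¬ (b ≤ a)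

  -- `AllPairs` relates entries at distinct positions, so two comparable members must sit at the
  -- same position.
  antichain-≤⇒≡ : ∀ {M a b} → AllPairs Incomparable M → a ∈ˡ M → b ∈ˡ M → a ≤ b → a ≡ b
  antichain-≤⇒≡ _        (here refl) (here refl) _   = refl
  antichain-≤⇒≡ (i ∷ _)  (here refl) (there b∈M) a≤b = contradiction a≤b (proj₁ (All.lookup i b∈M))
  antichain-≤⇒≡ (i ∷ _)  (there a∈M) (here refl) a≤b = contradiction a≤b (proj₂ (All.lookup i a∈M))
  antichain-≤⇒≡ (_ ∷ is) (there a∈M) (there b∈M) a≤b = antichain-≤⇒≡ is a∈M b∈M a≤b

  -- Insertion one element at a time. If `x` is already dominated it is dropped; otherwise it
  -- replaces the members above it. The members kept are not above `x`, and none is below `x` since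
  -- `x` lies outside `M ↑`.
  antichain : ∀ X → ∃[ M ] (AllPairs Incomparable M × All (_∈ˡ X) M × All (⟦ M ⟧ ↑) X)
  antichain []      = [] , [] , [] , []
  antichain (x ∷ X) with M , inc , M⊆X , X⊆M↑ ← antichain X with ↑? M x
  ... | yes x∈M↑ = M , inc , All.map there M⊆X , x∈M↑ ∷ X⊆M↑
  ... | no  x∉M↑ = x ∷ N , All.zip (all-filter _ M , all-filter⁺ _ ≰x) ∷ allPairs-filter⁺ _ inc
                 , here refl ∷ All.map there (all-filter⁺ _ M⊆X)
                 , (x , here refl , ≤-refl) ∷ All.map (↑-least (All.tabulate covered)) X⊆M↑
    where
    N : List Ω
    N = filter (λ m → ¬? (x ≤? m)) M

    ≰x : All (λ m → ¬ (m ≤ x)) M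
    ≰x = All.tabulate λ m∈M m≤x → x∉M↑ (_ , m∈M , m≤x)

    covered : ∀ {m} → m ∈ˡ M → m ∈ ⟦ x ∷ N ⟧ ↑
    covered {m} m∈M with x ≤? m
    ... | yes x≤m = x , here refl , x≤m
    ... | no  x≰m = m , there (∈-filter⁺ _ m∈M x≰m) , ≤-refl

  antichain⇒IsVmin : ∀ {V M} → UpwardClosed V → AllPairs Incomparable M →
                     All V M → V ⊆ ⟦ M ⟧ ↑ → IsVmin V M
  antichain⇒IsVmin {V} {M} (_ , V↑⊆V) inc M⊆V V⊆M↑ = record
    { minimal      = All.tabulate λ m∈M → All.lookup M⊆V m∈M , below m∈M
    ; inequivalent = AllPairs.map (λ (a≰b , _) (a≤b , _) → a≰b a≤b) inc
    -- A generator below `v` lies in `V`, so minimality of `v` makes the two equivalent.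
    ; complete     = λ (v∈V , min) → let m , m∈M , m≤v = V⊆M↑ v∈V in
                       lose m∈M (m≤v , min (All.lookup M⊆V m∈M) m≤v)
    ; generates    = V⊆M↑ , λ (m , m∈M , m≤a) → V↑⊆V (m , All.lookup M⊆V m∈M , m≤a)
    }
    where
    below : ∀ {m w} → m ∈ˡ M → w ∈ V → w ≤ m → m ≤ w
    -- Some generator `m′` satisfies `m′ ≤ w ≤ m`, and in an antichain this forces `m′` to be `m`.
    below m∈M w∈V w≤m with m′ , m′∈M , m′≤w ← V⊆M↑ w∈V
      with refl ← antichain-≤⇒≡ inc m′∈M m∈M (≤-trans m′≤w w≤m) = m′≤w

  -- next X must return something even when V ⊆ X↑, so that iterating it gives
  -- an infinite sequence to which goodness applies.
  module _ {V : Pred Ω 0ℓ}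
           (next : ∀ X → Σ[ v ∈ Ω ] (v ∈ V × (v ∈ ⟦ X ⟧ ↑ → V ⊆ ⟦ X ⟧ ↑))) where

    stage : ℕ → List Ω
    stage zero    = []
    stage (suc n) = proj₁ (next (stage n)) ∷ stage n

    stage⊆V : ∀ n → All V (stage n)
    stage⊆V zero    = []
    stage⊆V (suc n) = proj₁ (proj₂ (next (stage n))) ∷ stage⊆V n

    next∈stage : ∀ {i j} → i <ℕ j → proj₁ (next (stage i)) ∈ˡ stage j
    next∈stage {j = suc j} i<1+j with m<1+n⇒m<n∨m≡n i<1+j
    ... | inj₁ i<j  = there (next∈stage i<j)
    ... | inj₂ refl = here refl

    -- Goodness yields `i < j` with the `i`-th choice below the `j`-th. The `i`-th choice is already
    -- in `stage j`, so the `j`-th one lies in its upward closure, which by the specification of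
    -- `next` happens only once `V` is covered.
    generators-from-next : ∃[ X ] (All V X × V ⊆ ⟦ X ⟧ ↑)
    generators-from-next with i , j , i<j , fi≤fj ← good (proj₁ ∘ next ∘ stage) =
      stage j , stage⊆V j , proj₂ (proj₂ (next (stage j))) (_ , next∈stage i<j , fi≤fj)

  generators : ∀ {V} → (∀ X → Dec ∃⟨ V ∩ ∁ (⟦ X ⟧ ↑) ⟩) → ∃[ X ] (All V X × V ⊆ ⟦ X ⟧ ↑)
  generators {V} outside? with outside? []
  ... | no none           = [] , [] , λ v∈V → contradiction (_ , v∈V , λ ()) none
  ... | yes (v₀ , v₀∈V , _) = generators-from-next next
    where
    next : ∀ X → Σ[ v ∈ Ω ] (v ∈ V × (v ∈ ⟦ X ⟧ ↑ → V ⊆ ⟦ X ⟧ ↑))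
    next X with outside? X
    ... | yes (v , v∈V , v∉X↑) = v , v∈V , λ v∈X↑ → contradiction v∈X↑ v∉X↑
    -- `v₀` is a filler that keeps the sequence going. `none` gives only a double negation, removed
    -- by decidability of `X ↑`.
    ... | no none = v₀ , v₀∈V , λ _ {v} v∈V →
                      decidable-stable (↑? X v) λ v∉X↑ → none (v , v∈V , v∉X↑)

  Vmin-from-outside? : ∀ {V} → UpwardClosed V → (∀ X → Dec ∃⟨ V ∩ ∁ (⟦ X ⟧ ↑) ⟩) →
                       ∃[ M ] IsVmin V M
  Vmin-from-outside? up outside? =
    let X , X⊆V , V⊆X↑        = generators outside?
        M , inc , M⊆X , X⊆M↑  = antichain X
    in M , antichain⇒IsVmin up inc (All.map (All.lookup X⊆V) M⊆X) (↑-least X⊆M↑ ∘ V⊆X↑)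

  -- Testing the finitely many generators suffices: if all of them lie in `X ↑`, so does everything
  -- above them, that is, all of `V`.
  outside?-from-generators : ∀ {V : Pred Ω 0ℓ} M → V ≐ ⟦ M ⟧ ↑ → ∀ X → Dec ∃⟨ V ∩ ∁ (⟦ X ⟧ ↑) ⟩
  outside?-from-generators M (V⊆M↑ , M↑⊆V) X with any? (¬? ∘ ↑? X) M
  ... | yes some with m , m∈M , m∉X↑ ← find some = yes (m , M↑⊆V (m , m∈M , ≤-refl) , m∉X↑)
  ... | no none = no λ (v , v∈V , v∉X↑) → v∉X↑ (↑-least M⊆X↑ (V⊆M↑ v∈V))
    where
    M⊆X↑ : All (⟦ X ⟧ ↑) M
    M⊆X↑ = All.map (decidable-stable (↑? X _)) (¬Any⇒All¬ M none)

theorem6p2 : (Ω : Set) → FinitelyRepresented Ω →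
    (_≤_ : Rel Ω 0ℓ) → IsDecWellQuasiOrder _≤_ →
    let open Order _≤_ in
    (V : Pred Ω 0ℓ) → UpwardClosed V → RecursivelyEnumerable V →
    (∃[ M ] IsVmin V M) ⇔ ((X : List Ω) → Dec ∥ ∃⟨ V ∩ ∁ (⟦ X ⟧ ↑) ⟩ ∥)
theorem6p2 Ω _ _≤_ wqo V up re = mk⇔
  (λ (M , vmin) X → dec-∥∥⁺ (outside?-from-generators wqo M (Order.IsVmin.generates vmin) X))
  (λ outside? → Vmin-from-outside? wqo up λ X →
    dec-∥∥⁻ (∥∥-search-re re (¬? ∘ ↑? wqo X)) (outside? X))
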